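{- Let $r$ and $t$ be positive integers and let $G$ be a simple graph. Then $G$ is isomorphic to the double star $S_{r,t}$ if and only if both $$[x]\,da(G;x,y) = (r+t)y^{r+t+1}+y^{r+1}+y^{t+1}\quad\text{and}\quad [x^{r+t+2}]\,da(G;x,y) = y^{r+t+3}.$$
   Context: All graphs are finite, simple and have at least one vertex. For a graph $G$, $S\subseteq V(G)$ and $u\in V(G)$, let $\bar S=V(G)\setminus S$, let $\delta_S(u)=|\{v\in S:\{u,v\}\in E(G)\}|$, and let $G[S]$ be the subgraph induced by $S$. The defensive alliance polynomial of $G$ is $$da(G;x,y)=\sum_{S} x^{|S|}\,y^{f_y(S)},\qquad f_y(S)=\min_{u\in S}\bigl(\delta_S(u)-\delta_{\bar S}(u)+|V(G)|\bigr),$$ where the sum runs over all non-empty $S\subseteq V(G)$ such that $G[S]$ is connected (single-vertex graphs are connected). $[x^k]\,da(G;x,y)$ denotes the coefficient of $x^k$ in $da(G;x,y)$, which is a polynomial in $y$. The star $S_n$ is the graph with one center vertex adjacent to $n$ pairwise non-adjacent vertices. The double star $S_{r,t}$ is obtained from the disjoint union of the stars $S_r$ and $S_t$ by adding an edge between their two centers (so it has $r+t+2$ vertices). -}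

module Defs where

open import Algebra.Bundles.Raw using (RawMonoid)
open import Data.Fin.Base using (Fin; zero; suc; splitAt; _↑ˡ_; _↑ʳ_)
open import Data.Fin.Properties using (_≟_; all?)
open import Data.Fin.Subset using (Subset; inside; outside; _∈_; Nonempty; ∣_∣; ∁)
open import Data.Fin.Subset.Properties using (_∈?_; nonempty?)
open import Data.List.Base
  using (List; []; _∷_; _++_; map; foldr; filter; length; replicate; allFin)
open import Data.List.Extrema.Nat using (min)
import Data.List.Membership.Propositional as List
open import Data.List.Membership.Propositional.Properties using (∈-allFin)
open import Data.List.Properties using (length-filter; length-tabulate)
open import Data.List.Relation.Unary.Any using (here; there)
open import Data.Nat.Base using (ℕ; zero; suc; _+_; _∸_; _≤_; +-0-rawMonoid)
open import Data.Product.Base using (_×_; _,_; swap)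
open import Data.Sum.Base using (_⊎_; inj₁; inj₂)
import Data.Sum.Base as Sum
open import Data.Sum.Relation.Binary.Pointwise
  using (Pointwise; ⊎-symmetric; ⊎-decidable; ⊎-irreflexive; ≡⇒Pointwise-≡)
open import Data.Vec.Base using ([]; _∷_)
open import Function.Base using (_∘_; id)
open import Function.Bundles using (_↔_; _⇔_; Inverse)
open import Level using (0ℓ)
open import Relation.Binary.Construct.Closure.ReflexiveTransitive
  using (Star; ε; _◅_; _◅◅_)
open import Relation.Binary.Core using (Rel)
open import Relation.Binary.Definitions
  using (Symmetric; Irreflexive; Decidable; DecidableEquality)
open import Relation.Binary.PropositionalEquality
  using (_≡_; _≢_; refl; sym; subst)
open import Relation.Nullary using (Dec; yes; no)
open import Relation.Nullary.Decidable using (_×-dec_; _⊎-dec_; _→-dec_; map′)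

record Graph (n : ℕ) : Set₁ where
  infix 4 _~_ _~?_
  field
    _~_    : Rel (Fin n) 0ℓ
    ~-sym  : Symmetric _~_
    ~-irr  : Irreflexive _≡_ _~_
    _~?_   : Decidable _~_

infix 4 _≅_

record _≅_ {m n : ℕ} (G : Graph m) (H : Graph n) : Set where
  private
    module G = Graph G
    module H = Graph H
  field
    bijection : Fin m ↔ Fin n
  open Inverse bijection using (to)
  field
    preserves : ∀ u v → (u G.~ v) ⇔ (to u H.~ to v)

data StarAdj {n : ℕ} : Rel (Fin (suc n)) 0ℓ where
  centre-leaf : ∀ {i} → StarAdj zero (suc i)
  leaf-centre : ∀ {i} → StarAdj (suc i) zero

star : ∀ n → Graph (suc n)
star n = record
  { _~_   = StarAdj
  ; ~-sym = λ { centre-leaf → leaf-centre ; leaf-centre → centre-leaf }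
  ; ~-irr = λ { refl () }
  ; _~?_  = λ { zero    zero    → no λ ()
              ; zero    (suc _) → yes centre-leaf
              ; (suc _) zero    → yes leaf-centre
              ; (suc _) (suc _) → no λ () }
  }

infixr 6 _⊎ᴳ_

_⊎ᴳ_ : ∀ {m n} → Graph m → Graph n → Graph (m + n)
_⊎ᴳ_ {m} G H = record
  { _~_   = λ u v → Pointwise G._~_ H._~_ (splitAt m u) (splitAt m v)
  ; ~-sym = ⊎-symmetric G.~-sym H.~-sym
  ; ~-irr = λ { refl → ⊎-irreflexive G.~-irr H.~-irr (≡⇒Pointwise-≡ refl) }
  ; _~?_  = λ u v → ⊎-decidable G._~?_ H._~?_ (splitAt m u) (splitAt m v)
  }
  where
  module G = Graph G
  module H = Graph H

addEdge : ∀ {n} (G : Graph n) (a b : Fin n) → a ≢ b → Graph n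
addEdge G a b a≢b = record
  { _~_   = λ u v → u ~ v ⊎ (u ≡ a × v ≡ b) ⊎ (u ≡ b × v ≡ a)
  ; ~-sym = Sum.map ~-sym (Sum.swap ∘ Sum.map swap swap)
  ; ~-irr = λ { refl (inj₁ u~u)                   → ~-irr refl u~u
              ; refl (inj₂ (inj₁ (refl , a≡b)))   → a≢b a≡b
              ; refl (inj₂ (inj₂ (refl , b≡a)))   → a≢b (sym b≡a) }
  ; _~?_  = λ u v → (u ~? v) ⊎-dec ((u ≟ a) ×-dec (v ≟ b))
                             ⊎-dec ((u ≟ b) ×-dec (v ≟ a))
  }
  where open Graph G

-- The two endpoints of the new edge are the centres of the two stars.
doubleStar : ∀ r t → Graph (suc r + suc t)
doubleStar r t =
  addEdge (star r ⊎ᴳ star t) (zero ↑ˡ suc t) (suc r ↑ʳ zero) λ ()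

-- Reach ws relates the points joined by an R-path whose interior points all
-- lie in ws (Warshall's algorithm).

module Warshall {A : Set} (_≟ᴬ_ : DecidableEquality A)
                {R : Rel A 0ℓ} (R? : Decidable R) where

  Reach : List A → Rel A 0ℓ
  Reach []       u v = u ≡ v ⊎ R u v
  Reach (w ∷ ws) u v = Reach ws u v ⊎ (Reach ws u w × Reach ws w v)

  reach? : ∀ ws → Decidable (Reach ws)
  reach? []       u v = (u ≟ᴬ v) ⊎-dec R? u v
  reach? (w ∷ ws) u v =
    reach? ws u v ⊎-dec (reach? ws u w ×-dec reach? ws w v)

  sound : ∀ ws {u v} → Reach ws u v → Star R u v
  sound []       (inj₁ refl)    = ε
  sound []       (inj₂ uv)      = uv ◅ ε
  sound (w ∷ ws) (inj₁ p)       = sound ws p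
  sound (w ∷ ws) (inj₂ (p , q)) = sound ws p ◅◅ sound ws q

  weaken : ∀ ws {u v} → Reach [] u v → Reach ws u v
  weaken []       p = p
  weaken (w ∷ ws) p = inj₁ (weaken ws p)

  toPivot : ∀ w ws {u} → Reach (w ∷ ws) u w → Reach ws u w
  toPivot w ws (inj₁ p)       = p
  toPivot w ws (inj₂ (p , _)) = p

  fromPivot : ∀ w ws {v} → Reach (w ∷ ws) w v → Reach ws w v
  fromPivot w ws (inj₁ p)       = p
  fromPivot w ws (inj₂ (_ , p)) = p

  join : ∀ ws {u w v} → w List.∈ ws → Reach ws u w → Reach ws w v → Reach ws u v
  join (w ∷ ws) (here refl) p q = inj₂ (toPivot w ws p , fromPivot w ws q)
  join (_ ∷ ws) (there i) (inj₁ p)        (inj₁ q)        = inj₁ (join ws i p q)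
  join (_ ∷ ws) (there i) (inj₁ p)        (inj₂ (q , q′)) = inj₂ (join ws i p q , q′)
  join (_ ∷ ws) (there i) (inj₂ (p , p′)) (inj₁ q)        = inj₂ (p , join ws i p′ q)
  join (_ ∷ ws) (there i) (inj₂ (p , _))  (inj₂ (_ , q))  = inj₂ (p , q)

  complete : ∀ ws → (∀ w → w List.∈ ws) → ∀ {u v} → Star R u v → Reach ws u v
  complete ws full ε        = weaken ws (inj₁ refl)
  complete ws full (p ◅ ps) =
    join ws (full _) (weaken ws (inj₂ p)) (complete ws full ps)

  star? : ∀ ws → (∀ w → w List.∈ ws) → Decidable (Star R)
  star? ws full u v = map′ (sound ws) (complete ws full) (reach? ws u v)

-- Polynomials with coefficients in a monoid, as lists of
-- coefficients in order of increasing degree. Trailing zeros are allowed,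
-- so equality is coefficientwise.

module Polynomial (M : RawMonoid 0ℓ 0ℓ) where

  open RawMonoid M renaming (ε to 0#; _∙_ to _+ᴹ_)

  infixl 6 _⊞_

  coeff : List Carrier → ℕ → Carrier
  coeff []      _       = 0#
  coeff (a ∷ p) zero    = a
  coeff (a ∷ p) (suc k) = coeff p k

  _⊞_ : List Carrier → List Carrier → List Carrier
  []      ⊞ q       = q
  (a ∷ p) ⊞ []      = a ∷ p
  (a ∷ p) ⊞ (b ∷ q) = (a +ᴹ b) ∷ (p ⊞ q)

  monomial : Carrier → ℕ → List Carrier
  monomial a k = replicate k 0# ++ a ∷ []

  rawMonoid : RawMonoid 0ℓ 0ℓ
  rawMonoid = record
    { Carrier = List Carrier
    ; _≈_     = λ p q → ∀ k → coeff p k ≈ coeff q k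
    ; _∙_     = _⊞_
    ; ε       = []
    }

-- All coefficients involved are natural numbers, and ℕ[y] embeds in ℤ[y].

ℕ[y] ℕ[y][x] : RawMonoid 0ℓ 0ℓ
ℕ[y]    = Polynomial.rawMonoid +-0-rawMonoid
ℕ[y][x] = Polynomial.rawMonoid ℕ[y]

open RawMonoid ℕ[y] public
  using () renaming (_∙_ to infixl 6 _⊕_; _≈_ to infix 4 _≈ʸ_)

infix  7 _·y^_ _·x^_

_·y^_ : ℕ → ℕ → RawMonoid.Carrier ℕ[y]
_·y^_ = Polynomial.monomial +-0-rawMonoid

_·x^_ : RawMonoid.Carrier ℕ[y] → ℕ → RawMonoid.Carrier ℕ[y][x]
_·x^_ = Polynomial.monomial ℕ[y]

infix 8 [x^_]_

[x^_]_ : ℕ → RawMonoid.Carrier ℕ[y][x] → RawMonoid.Carrier ℕ[y]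
[x^ k ] p = Polynomial.coeff ℕ[y] p k

allSubsets : ∀ n → List (Subset n)
allSubsets zero    = [] ∷ []
allSubsets (suc n) =
  map (outside ∷_) (allSubsets n) ++ map (inside ∷_) (allSubsets n)

module _ {n : ℕ} (G : Graph n) where

  open Graph G

  δ : Subset n → Fin n → ℕ
  δ S u = length (filter (λ v → (v ∈? S) ×-dec (u ~? v)) (allFin n))

  δ≤n : ∀ S u → δ S u ≤ n
  δ≤n S u = subst (δ S u ≤_) (length-tabulate id)
    (length-filter (λ v → (v ∈? S) ×-dec (u ~? v)) (allFin n))

  -- G[S] keeps the vertices outside S as isolated points; Connected only
  -- quantifies over S. It holds of the empty set, which da excludes separately.
  Induced : Subset n → Rel (Fin n) 0ℓ
  Induced S u v = u ∈ S × v ∈ S × u ~ v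

  Connected : Subset n → Set
  Connected S = ∀ u → u ∈ S → ∀ v → v ∈ S → Star (Induced S) u v

  connected? : ∀ S → Dec (Connected S)
  connected? S =
    all? λ u → (u ∈? S) →-dec all? λ v → (v ∈? S) →-dec star? (allFin n) ∈-allFin u v
    where
    open Warshall _≟_ {Induced S} (λ u v → (u ∈? S) ×-dec (v ∈? S) ×-dec (u ~? v))

  -- The monus never truncates, by δ≤n.
  alliance : Subset n → Fin n → ℕ
  alliance S u = (δ S u + n) ∸ δ (∁ S) u

  -- min a xs is the minimum of a and all of xs; the default value used here
  -- is itself attained on S, so this is the minimum over S.
  f-y : (S : Subset n) → Nonempty S → ℕ
  f-y S (u , _) = min (alliance S u) (map (alliance S) (filter (_∈? S) (allFin n)))

  term : Subset n → RawMonoid.Carrier ℕ[y][x]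
  term S with nonempty? S ×-dec connected? S
  ... | yes (ne , _) = (1 ·y^ f-y S ne) ·x^ ∣ S ∣
  ... | no _         = RawMonoid.ε ℕ[y][x]

  da : RawMonoid.Carrier ℕ[y][x]
  da = foldr (RawMonoid._∙_ ℕ[y][x]) (RawMonoid.ε ℕ[y][x])
         (map term (allSubsets n))

{-# OPTIONS --safe #-}
module Submission where

-- The coefficient of x comes from the single vertices and equals the sum of
-- y^(n − deg u), so it determines n and the degrees; the coefficient of x^n comes
-- from the whole vertex set, so it is nonzero iff G is connected. A connected graph
-- with r + t vertices of degree 1 and two further vertices c, d of degrees r + 1
-- and t + 1 is a double star: two adjacent vertices of degree 1 would form a
-- component, and if c and d were not adjacent then c and its leaves would.

open import Defs
open import Algebra.Bundles.Raw using (RawMonoid)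
open import Algebra.Definitions using (LeftIdentity; RightIdentity)
open import Data.Fin.Base using (Fin; zero; suc; cast; join; splitAt; _↑ˡ_; _↑ʳ_)
open import Data.Fin.Properties
  using ( cast-is-id; join-splitAt; splitAt-↑ˡ; splitAt-↑ʳ
        ; splitAt⁻¹-↑ˡ; splitAt⁻¹-↑ʳ)
open import Data.Fin.Subset
  using (Subset; inside; outside; Nonempty; ∣_∣; ⊥; ⊤; ⁅_⁆; ∁) renaming (_∈_ to _∈ₛ_)
open import Data.Fin.Subset.Properties
  using ( _∈?_; nonempty?; ∣p∣≤n; ∈⊤; ∣⊤∣≡n; x∈⁅x⁆; x∈⁅y⁆⇒x≡y; ∣⁅x⁆∣≡1
        ; x∈p⇒x∉∁p; x∉p⇒x∈∁p)
open import Data.List.Base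
  using ( List; []; _∷_; _++_; map; foldr; filter; length; lookup; replicate
        ; allFin; tabulate)
open import Data.List.Extrema.Nat using (min≈v⁺)
open import Data.List.Membership.Propositional using (_∈_; _∉_)
open import Data.List.Membership.Propositional.Properties
  using ( ∈-∃++; ∈-++⁻; ∈-map⁺; ∈-filter⁺; ∈-filter⁻; ∈-lookup; ∈-tabulate⁺
        ; ∈-tabulate⁻; ∈-allFin)
open import Data.List.Membership.Propositional.Properties.WithK using (unique∧set⇒bag)
open import Data.List.Properties
  using ( map-++; map-∘; map-tabulate; tabulate-cong; tabulate-lookup
        ; length-tabulate; length-++; length-map; length-replicate; length-filter
        ; filter-none; filter-≐; filter-accept; filter-reject; filter-all; filter-++
        ; partition-defn; ∷-injectiveˡ; ∷-injectiveʳ)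
open import Data.List.Relation.Binary.BagAndSetEquality using (∼bag⇒↭)
open import Data.List.Relation.Binary.Permutation.Propositional
  using ( _↭_; ↭-refl; ↭-reflexive; ↭-sym; ↭-trans; ↭-prep; ↭-swap
        ; ↭⇒↭ₛ; ↭ₛ⇒↭)
open import Data.List.Relation.Binary.Permutation.Propositional.Properties
  using (map⁺; ↭-map-inv; ↭-length; ∈-resp-↭; shift; ++-comm)
import Data.List.Relation.Binary.Permutation.Setoid.Properties as Permutationₛ
open import Data.List.Relation.Unary.All as All using (All; []; _∷_)
import Data.List.Relation.Unary.All.Properties as All
open import Data.List.Relation.Unary.Any using (here; there)
open import Data.List.Relation.Unary.Unique.Propositional using (Unique; _∷_)
import Data.List.Relation.Unary.Unique.Propositional.Properties as Unique
open import Data.List.Relation.Unary.Unique.Propositional.Properties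
  using (allFin⁺; Unique[x∷xs]⇒x∉xs)
open import Data.Nat.Base
  using ( ℕ; zero; suc; _+_; _∸_; _≤_; _<_; z≤n; s≤s; NonZero; >-nonZero⁻¹
        ; +-0-rawMonoid)
open import Data.Nat.ListAction using (sum)
open import Data.Nat.ListAction.Properties using (sum-++; sum-↭)
open import Data.Nat.Properties
  using ( _≟_; +-identityˡ; +-identityʳ; +-comm; +-suc; +-cancelˡ-≡; +-monoˡ-≤
        ; suc-injective; 1+n≢0; ≤-reflexive; <⇒≢; m+n∸m≡n; m+n∸n≡m; m∸[m∸n]≡n)
open import Data.Nat.Tactic.RingSolver using (solve-∀)
open import Data.Product.Base using (∃; _×_; _,_; proj₁; proj₂)
open import Data.Sum.Base using (_⊎_; inj₁; inj₂)
open import Data.Sum.Relation.Binary.Pointwise using (Pointwise; inj₁; inj₂)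
open import Data.Vec.Base using ([]; _∷_)
open import Function.Base using (_∘_; id)
open import Function.Bundles using (_⇔_; mk⇔; mk↔ₛ′; Equivalence; Inverse)
open import Level using (0ℓ)
open import Relation.Binary.Construct.Closure.ReflexiveTransitive
  using (Star; ε; _◅_; _◅◅_; reverse)
open import Relation.Binary.PropositionalEquality
  using (_≡_; _≢_; refl; sym; trans; cong; cong₂; subst; subst₂; module ≡-Reasoning)
open import Relation.Binary.PropositionalEquality.Properties using (setoid)
open import Relation.Nullary using (¬_; yes; no; contradiction)
open import Relation.Nullary.Decidable using (_×-dec_; decidable-stable)
open import Relation.Unary using (Pred; Decidable)
open import Relation.Unary.Properties using (∁?)

open Equivalence using (to; from)

-- Both directions pass through `Layout`, a description of the double star inside `G` by lists of
-- vertices; it keeps the counting of degrees apart from the index arithmetic of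
-- `Fin (suc r + suc t)`. Polynomials are compared coefficientwise, so the coefficient of x is first
-- turned into a multiset of exponents, that is, a list up to permutation. The exponent r + t + 3 is
-- n + 1: on the whole vertex set a vertex u contributes deg u + n, and the minimum is attained at a
-- vertex of degree 1.

module PolynomialProperties
  (M : RawMonoid 0ℓ 0ℓ)
  (identityˡ : LeftIdentity _≡_ (RawMonoid.ε M) (RawMonoid._∙_ M))
  (identityʳ : RightIdentity _≡_ (RawMonoid.ε M) (RawMonoid._∙_ M))
  where

  open RawMonoid M renaming (ε to 0#; _∙_ to _+ᴹ_)
  open Polynomial M

  coeff-⊞ : ∀ p q k → coeff (p ⊞ q) k ≡ coeff p k +ᴹ coeff q k
  coeff-⊞ []      q       k       = sym (identityˡ _)
  coeff-⊞ (a ∷ p) []      k       = sym (identityʳ _)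
  coeff-⊞ (a ∷ p) (b ∷ q) zero    = refl
  coeff-⊞ (a ∷ p) (b ∷ q) (suc k) = coeff-⊞ p q k

  coeff-foldr : ∀ ps k →
    coeff (foldr _⊞_ [] ps) k ≡ foldr _+ᴹ_ 0# (map (λ p → coeff p k) ps)
  coeff-foldr []       k = refl
  coeff-foldr (p ∷ ps) k =
    trans (coeff-⊞ p (foldr _⊞_ [] ps) k) (cong (coeff p k +ᴹ_) (coeff-foldr ps k))

  coeff-monomial-≡ : ∀ a k → coeff (monomial a k) k ≡ a
  coeff-monomial-≡ a zero    = refl
  coeff-monomial-≡ a (suc k) = coeff-monomial-≡ a k

  coeff-monomial-≢ : ∀ a {j k} → j ≢ k → coeff (monomial a j) k ≡ 0#
  coeff-monomial-≢ a {zero}  {zero}  j≢k = contradiction refl j≢k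
  coeff-monomial-≢ a {zero}  {suc k} j≢k = refl
  coeff-monomial-≢ a {suc j} {zero}  j≢k = refl
  coeff-monomial-≢ a {suc j} {suc k} j≢k = coeff-monomial-≢ a (j≢k ∘ cong suc)

-- Polynomials in y as multisets of exponents.

open Polynomial +-0-rawMonoid using () renaming (coeff to coeffʸ)
open PolynomialProperties +-0-rawMonoid +-identityˡ +-identityʳ using ()
  renaming ( coeff-⊞ to coeffʸ-⊕; coeff-foldr to coeffʸ-foldr
           ; coeff-monomial-≡ to coeffʸ-monomial-≡; coeff-monomial-≢ to coeffʸ-monomial-≢)

-- This law holds for the lists themselves, although polynomials are only compared coefficientwise.
-- Hence coefficients of powers of x can be computed up to `_≡_` and rewritten with `cong`.
⊕-identityʳ : RightIdentity _≡_ [] _⊕_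
⊕-identityʳ []      = refl
⊕-identityʳ (a ∷ p) = refl

open PolynomialProperties ℕ[y] (λ _ → refl) ⊕-identityʳ using ()
  renaming ( coeff-foldr to coeffˣ-foldr
           ; coeff-monomial-≡ to coeffˣ-monomial-≡; coeff-monomial-≢ to coeffˣ-monomial-≢)

-- The number of occurrences of j in es, read off as the coefficient of y^j in the sum
-- of the monomials y^e.
count : ℕ → List ℕ → ℕ
count j es = sum (map (λ e → coeffʸ (1 ·y^ e) j) es)

count-↭ : ∀ {ds es} → ds ↭ es → ∀ j → count j ds ≡ count j es
count-↭ ds↭es j = sum-↭ (map⁺ _ ds↭es)

coeffʸ-monomial : ∀ k e j → coeffʸ (k ·y^ e) j ≡ count j (replicate k e)
coeffʸ-monomial k e j with e ≟ j
... | yes refl = trans (coeffʸ-monomial-≡ k e) (all-equal k)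
  where
  all-equal : ∀ k → k ≡ count e (replicate k e)
  all-equal zero    = refl
  all-equal (suc k) = cong₂ _+_ (sym (coeffʸ-monomial-≡ 1 e)) (all-equal k)
... | no e≢j = trans (coeffʸ-monomial-≢ k e≢j) (none-equal k)
  where
  none-equal : ∀ k → 0 ≡ count j (replicate k e)
  none-equal zero    = refl
  none-equal (suc k) = cong₂ _+_ (sym (coeffʸ-monomial-≢ 1 e≢j)) (none-equal k)

count≢0⇒∈ : ∀ j es → count j es ≢ 0 → j ∈ es
count≢0⇒∈ j []       ≢0 = contradiction refl ≢0
count≢0⇒∈ j (e ∷ es) ≢0 with e ≟ j
... | yes refl = here refl
... | no e≢j   = there (count≢0⇒∈ j es
  (≢0 ∘ cong₂ _+_ (coeffʸ-monomial-≢ 1 e≢j)))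

count-head≢0 : ∀ e es → count e (e ∷ es) ≢ 0
count-head≢0 e es ≡0 =
  1+n≢0 (trans (cong (_+ count e es) (sym (coeffʸ-monomial-≡ 1 e))) ≡0)

-- The head `d` has a non-zero count, so it occurs in `es`; removing one occurrence on each side
-- lowers all counts equally, and induction treats the rest.
count-injective : ∀ ds es → (∀ j → count j ds ≡ count j es) → ds ↭ es
count-injective []       []       eq = ↭-refl
count-injective []       (e ∷ es) eq = contradiction (sym (eq e)) (count-head≢0 e es)
count-injective (d ∷ ds) es       eq
  with fs , gs , refl ← ∈-∃++ (count≢0⇒∈ d es (count-head≢0 d ds ∘ trans (eq d))) =
  ↭-trans
    (↭-prep d (count-injective ds (fs ++ gs) λ j →
      +-cancelˡ-≡ (coeffʸ (1 ·y^ d) j) _ _ (trans (eq j) (count-↭ (shift d fs gs) j))))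
    (↭-sym (shift d fs gs))

-- The values n - deg u for n = r + t + 2. The first entry belongs to the centre of degree r + 1 and
-- the second to the one of degree t + 1, which is why r and t appear crossed over.
doubleStarExponents : ℕ → ℕ → List ℕ
doubleStarExponents r t = (t + 1) ∷ (r + 1) ∷ replicate (r + t) (r + t + 1)

coeffʸ-doubleStar : ∀ r t j →
  coeffʸ ((r + t) ·y^ (r + t + 1) ⊕ 1 ·y^ (r + 1) ⊕ 1 ·y^ (t + 1)) j ≡ count j (doubleStarExponents r t)
coeffʸ-doubleStar r t j = begin
  coeffʸ (A ⊕ B ⊕ C) j                   ≡⟨ coeffʸ-⊕ (A ⊕ B) C j ⟩
  coeffʸ (A ⊕ B) j + coeffʸ C j          ≡⟨ cong (_+ coeffʸ C j) (coeffʸ-⊕ A B j) ⟩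
  coeffʸ A j + coeffʸ B j + coeffʸ C j   ≡⟨ cong (λ k → k + coeffʸ B j + coeffʸ C j)
                                              (coeffʸ-monomial (r + t) (r + t + 1) j) ⟩
  _                                      ≡⟨ arith (count j Aˢ) (coeffʸ B j) (coeffʸ C j) ⟩
  count j (doubleStarExponents r t)      ∎
  where
  open ≡-Reasoning
  A  = (r + t) ·y^ (r + t + 1)
  Aˢ = replicate (r + t) (r + t + 1)
  B  = 1 ·y^ (r + 1)
  C  = 1 ·y^ (t + 1)
  arith : ∀ a b c → a + b + c ≡ c + (b + a)
  arith = solve-∀

-- Sums over all subsets whose terms vanish outside one size.

sum-map-zero : ∀ {A : Set} {f : A → ℕ} → (∀ x → f x ≡ 0) → ∀ xs → sum (map f xs) ≡ 0
sum-map-zero f≡0 []       = refl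
sum-map-zero f≡0 (x ∷ xs) = cong₂ _+_ (f≡0 x) (sum-map-zero f≡0 xs)

sum-allSubsets-suc : ∀ {n} (f : Subset (suc n) → ℕ) →
  sum (map f (allSubsets (suc n))) ≡
  sum (map (f ∘ (outside ∷_)) (allSubsets n)) + sum (map (f ∘ (inside ∷_)) (allSubsets n))
sum-allSubsets-suc {n} f = begin
  sum (map f (outs ++ ins))              ≡⟨ cong sum (map-++ f outs ins) ⟩
  sum (map f outs ++ map f ins)          ≡⟨ sum-++ (map f outs) (map f ins) ⟩
  sum (map f outs) + sum (map f ins)     ≡⟨ cong₂ (λ ms ns → sum ms + sum ns)
                                              (map-∘ (allSubsets n)) (map-∘ (allSubsets n)) ⟨
  sum (map (f ∘ (outside ∷_)) (allSubsets n)) + sum (map (f ∘ (inside ∷_)) (allSubsets n)) ∎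
  where
  open ≡-Reasoning
  outs = map (outside ∷_) (allSubsets n)
  ins  = map (inside  ∷_) (allSubsets n)

sum-size-0 : ∀ {n} (f : Subset n → ℕ) → (∀ S → ∣ S ∣ ≢ 0 → f S ≡ 0) →
  sum (map f (allSubsets n)) ≡ f ⊥
sum-size-0 {zero}  f f≡0 = +-identityʳ (f [])
sum-size-0 {suc n} f f≡0 = begin
  sum (map f (allSubsets (suc n)))  ≡⟨ sum-allSubsets-suc f ⟩
  _                                 ≡⟨ cong₂ _+_ (sum-size-0 _ λ S → f≡0 (outside ∷ S))
                                         (sum-map-zero (λ S → f≡0 (inside ∷ S) 1+n≢0)
                                           (allSubsets n)) ⟩
  f ⊥ + 0                           ≡⟨ +-identityʳ (f ⊥) ⟩
  f ⊥                               ∎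
  where open ≡-Reasoning

-- A one-element subset either omits `zero` and is a singleton further on, or contains `zero` and is
-- empty further on; hence the recursive call at size 1 and the appeal to size 0.
sum-size-1 : ∀ {n} (f : Subset n → ℕ) → (∀ S → ∣ S ∣ ≢ 1 → f S ≡ 0) →
  sum (map f (allSubsets n)) ≡ sum (tabulate (f ∘ ⁅_⁆))
sum-size-1 {zero}  f f≡0 = trans (+-identityʳ (f [])) (f≡0 [] λ ())
sum-size-1 {suc n} f f≡0 = begin
  sum (map f (allSubsets (suc n)))  ≡⟨ sum-allSubsets-suc f ⟩
  _                                 ≡⟨ cong₂ _+_ (sum-size-1 _ λ S → f≡0 (outside ∷ S))
                                         (sum-size-0 _ λ S S≢0 →
                                           f≡0 (inside ∷ S) (S≢0 ∘ suc-injective)) ⟩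
  sum (tabulate (f ∘ (outside ∷_) ∘ ⁅_⁆)) + f ⁅ zero ⁆  ≡⟨ +-comm _ (f ⁅ zero ⁆) ⟩
  sum (tabulate (f ∘ ⁅_⁆))          ∎
  where open ≡-Reasoning

sum-size-n : ∀ {n} (f : Subset n → ℕ) → (∀ S → ∣ S ∣ ≢ n → f S ≡ 0) →
  sum (map f (allSubsets n)) ≡ f ⊤
sum-size-n {zero}  f f≡0 = +-identityʳ (f [])
sum-size-n {suc n} f f≡0 = begin
  sum (map f (allSubsets (suc n)))  ≡⟨ sum-allSubsets-suc f ⟩
  _                                 ≡⟨ cong₂ _+_
                                         (sum-map-zero (λ S → f≡0 (outside ∷ S)
                                           (<⇒≢ (s≤s (∣p∣≤n S)))) (allSubsets n))
                                         (sum-size-n _ λ S S≢n →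
                                           f≡0 (inside ∷ S) (S≢n ∘ suc-injective)) ⟩
  f ⊤                               ∎
  where open ≡-Reasoning

-- The coefficients of x and x^n in `da`.

module _ {n : ℕ} (G : Graph n) where

  open Graph G

  degree : Fin n → ℕ
  degree u = length (filter (u ~?_) (allFin n))

  exponent : Fin n → ℕ
  exponent u = n ∸ degree u

  δ-none : ∀ S u → (∀ v → v ∈ₛ S → ¬ u ~ v) → δ G S u ≡ 0
  δ-none S u ¬~ = cong length (filter-none (λ v → (v ∈? S) ×-dec (u ~? v))
    (All.universal (λ v (v∈S , u~v) → ¬~ v v∈S u~v) (allFin n)))

  δ-all : ∀ S u → (∀ v → u ~ v → v ∈ₛ S) → δ G S u ≡ degree u
  δ-all S u ~⇒∈ = cong length (filter-≐ (λ v → (v ∈? S) ×-dec (u ~? v)) (u ~?_)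
    (proj₂ , λ u~v → ~⇒∈ _ u~v , u~v) (allFin n))

  -- Without loops, `u` has no neighbour in its singleton, so all its neighbours count against it.
  alliance-⁅⁆ : ∀ u → alliance G ⁅ u ⁆ u ≡ exponent u
  alliance-⁅⁆ u = cong₂ (λ k l → (k + n) ∸ l)
    (δ-none ⁅ u ⁆ u λ v v∈⁅u⁆ → ~-irr (sym (x∈⁅y⁆⇒x≡y u v∈⁅u⁆)))
    (δ-all (∁ ⁅ u ⁆) u λ v u~v → x∉p⇒x∈∁p λ v∈⁅u⁆ → ~-irr (sym (x∈⁅y⁆⇒x≡y u v∈⁅u⁆)) u~v)

  alliance-⊤ : ∀ u → alliance G ⊤ u ≡ degree u + n
  alliance-⊤ u = cong₂ (λ k l → (k + n) ∸ l)
    (δ-all ⊤ u λ _ _ → ∈⊤)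
    (δ-none (∁ ⊤) u λ v v∈∁⊤ → contradiction v∈∁⊤ (x∈p⇒x∉∁p ∈⊤))

  -- The default value inside `f-y` comes from the witness `ne`, but it is itself attained on `S`
  -- and so cannot undercut the minimum. The result is therefore the same for every witness.
  f-y-minimum : ∀ S ne {u} → u ∈ₛ S → (∀ v → v ∈ₛ S → alliance G S u ≤ alliance G S v) →
    f-y G S ne ≡ alliance G S u
  f-y-minimum S (v , v∈S) {u} u∈S minimal = min≈v⁺
    (∈-map⁺ (alliance G S) (∈-filter⁺ (_∈? S) (∈-allFin u) u∈S))
    (All.map⁺ (All.map (λ {w} → minimal w) (All.all-filter (_∈? S) (allFin n))))
    (minimal v v∈S)

  -- The witness is existential because `term` uses the one found by `nonempty?`, which may differ
  -- from the one supplied.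
  term-connected : ∀ {S} → Nonempty S → Connected G S →
    ∃ λ ne → term G S ≡ (1 ·y^ f-y G S ne) ·x^ ∣ S ∣
  term-connected {S} ne conn with nonempty? S ×-dec connected? G S
  ... | yes (ne′ , _) = ne′ , refl
  ... | no ¬p         = contradiction (ne , conn) ¬p

  term-disconnected : ∀ {S} → ¬ Connected G S → term G S ≡ []
  term-disconnected {S} ¬conn with nonempty? S ×-dec connected? G S
  ... | yes (_ , conn) = contradiction conn ¬conn
  ... | no _           = refl

  [x^]term-≢ : ∀ S {k} → ∣ S ∣ ≢ k → [x^ k ] term G S ≡ []
  [x^]term-≢ S ∣S∣≢k with nonempty? S ×-dec connected? G S
  ... | yes _ = coeffˣ-monomial-≢ _ ∣S∣≢k
  ... | no _  = refl

  [x^]term-minimum : ∀ {S k u} → ∣ S ∣ ≡ k → Connected G S →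
    u ∈ₛ S → (∀ v → v ∈ₛ S → alliance G S u ≤ alliance G S v) →
    [x^ k ] term G S ≡ 1 ·y^ alliance G S u
  [x^]term-minimum {S} {u = u} refl conn u∈S minimal
    with ne , eq ← term-connected (u , u∈S) conn = begin
      [x^ ∣ S ∣ ] term G S  ≡⟨ cong ([x^ ∣ S ∣ ]_) eq ⟩
      _                     ≡⟨ coeffˣ-monomial-≡ _ ∣ S ∣ ⟩
      1 ·y^ f-y G S ne      ≡⟨ cong (1 ·y^_) (f-y-minimum S ne u∈S minimal) ⟩
      1 ·y^ alliance G S u  ∎
    where open ≡-Reasoning

  coeff-da : ∀ k j →
    coeffʸ ([x^ k ] da G) j ≡ sum (map (λ S → coeffʸ ([x^ k ] term G S) j) (allSubsets n))
  coeff-da k j = begin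
    coeffʸ ([x^ k ] da G) j
      ≡⟨ cong (λ p → coeffʸ p j) (coeffˣ-foldr terms k) ⟩
    coeffʸ (foldr _⊕_ [] (map ([x^ k ]_) terms)) j
      ≡⟨ coeffʸ-foldr (map ([x^ k ]_) terms) j ⟩
    sum (map (λ p → coeffʸ p j) (map ([x^ k ]_) terms))
      ≡⟨ cong sum (map-∘ terms) ⟨
    sum (map (λ p → coeffʸ ([x^ k ] p) j) terms)
      ≡⟨ cong sum (map-∘ (allSubsets n)) ⟨
    sum (map (λ S → coeffʸ ([x^ k ] term G S) j) (allSubsets n)) ∎
    where
    open ≡-Reasoning
    terms = map (term G) (allSubsets n)

  connected-⁅⁆ : ∀ u → Connected G ⁅ u ⁆
  connected-⁅⁆ u v v∈ w w∈ rewrite x∈⁅y⁆⇒x≡y u v∈ | x∈⁅y⁆⇒x≡y u w∈ = ε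

  [x]term-⁅⁆ : ∀ u → [x^ 1 ] term G ⁅ u ⁆ ≡ 1 ·y^ exponent u
  [x]term-⁅⁆ u = trans
    ([x^]term-minimum (∣⁅x⁆∣≡1 u) (connected-⁅⁆ u) (x∈⁅x⁆ u) λ v v∈⁅u⁆ →
      ≤-reflexive (cong (alliance G ⁅ u ⁆) (sym (x∈⁅y⁆⇒x≡y u v∈⁅u⁆))))
    (cong (1 ·y^_) (alliance-⁅⁆ u))

  coeff-[x]da : ∀ j → coeffʸ ([x^ 1 ] da G) j ≡ count j (map exponent (allFin n))
  coeff-[x]da j = begin
    coeffʸ ([x^ 1 ] da G) j
      ≡⟨ coeff-da 1 j ⟩
    sum (map (λ S → coeffʸ ([x^ 1 ] term G S) j) (allSubsets n))
      ≡⟨ sum-size-1 _ (λ S ∣S∣≢1 → cong (λ p → coeffʸ p j) ([x^]term-≢ S ∣S∣≢1)) ⟩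
    sum (tabulate (λ u → coeffʸ ([x^ 1 ] term G ⁅ u ⁆) j))
      ≡⟨ cong sum (tabulate-cong λ u → cong (λ p → coeffʸ p j) ([x]term-⁅⁆ u)) ⟩
    sum (tabulate (λ u → coeffʸ (1 ·y^ exponent u) j))
      ≡⟨ cong sum (map-tabulate exponent (λ e → coeffʸ (1 ·y^ e) j)) ⟨
    count j (tabulate exponent)
      ≡⟨ cong (count j) (map-tabulate id exponent) ⟨
    count j (map exponent (allFin n)) ∎
    where open ≡-Reasoning

  coeff-[xⁿ]da : ∀ j → coeffʸ ([x^ n ] da G) j ≡ coeffʸ ([x^ n ] term G ⊤) j
  coeff-[xⁿ]da j = trans (coeff-da n j)
    (sum-size-n _ λ S ∣S∣≢n → cong (λ p → coeffʸ p j) ([x^]term-≢ S ∣S∣≢n))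

-- Lists up to permutation.

module _ {A : Set} where

  Unique-resp-↭ : {xs ys : List A} → xs ↭ ys → Unique xs → Unique ys
  Unique-resp-↭ = Permutationₛ.Unique-resp-↭ (setoid A) ∘ ↭⇒↭ₛ

  filter-↭ : ∀ {p} {P : Pred A p} (P? : Decidable P) {xs ys} →
    xs ↭ ys → filter P? xs ↭ filter P? ys
  filter-↭ P? = ↭ₛ⇒↭ ∘ Permutationₛ.filter⁺ (setoid A) P? (λ { refl → id }) ∘ ↭⇒↭ₛ

  filter-∁-↭ : ∀ {p} {P : Pred A p} (P? : Decidable P) xs →
    xs ↭ filter P? xs ++ filter (∁? P?) xs
  filter-∁-↭ P? xs = subst (λ (ys , zs) → xs ↭ ys ++ zs) (partition-defn P? xs)
    (↭ₛ⇒↭ (Permutationₛ.partition-↭ (setoid A) P? xs))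

  map-All-≡ : ∀ {B : Set} {f : A → B} {b xs} → All (λ x → f x ≡ b) xs →
    map f xs ≡ replicate (length xs) b
  map-All-≡ []         = refl
  map-All-≡ (eq ∷ eqs) = cong₂ _∷_ eq (map-All-≡ eqs)

-- Layouts, their degrees and their connectivity.

module _ {n : ℕ} (G : Graph n) where

  open Graph G

  -- The equivalence determines the whole neighbourhood of `x`: every question about an edge at `x`
  -- becomes an equation with `w`.
  LeafOf : Fin n → Fin n → Set
  LeafOf w x = ∀ y → x ~ y ⇔ y ≡ w

  degree-↭ : ∀ u {xs} → allFin n ↭ xs → degree G u ≡ length (filter (u ~?_) xs)
  degree-↭ u = ↭-length ∘ filter-↭ (u ~?_)

  -- Once `w` is moved to the front of the vertex list, the filter keeps it and drops everything
  -- else, because `w` occurs only once.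
  degree-leaf : ∀ {w x} → LeafOf w x → degree G x ≡ 1
  degree-leaf {w} {x} leaf with as , bs , eq ← ∈-∃++ (∈-allFin w) = begin
    degree G x
      ≡⟨ degree-↭ x front ⟩
    length (filter (x ~?_) (w ∷ as ++ bs))
      ≡⟨ cong length (filter-accept (x ~?_) (from (leaf w) refl)) ⟩
    suc (length (filter (x ~?_) (as ++ bs)))
      ≡⟨ cong (suc ∘ length) (filter-none (x ~?_)
           (All.tabulate λ y∈ x~y → w∉ (subst (_∈ as ++ bs) (to (leaf _) x~y) y∈))) ⟩
    1 ∎
    where
    open ≡-Reasoning
    front : allFin n ↭ w ∷ as ++ bs
    front = ↭-trans (↭-reflexive eq) (shift w as bs)
    w∉ : w ∉ as ++ bs
    w∉ = Unique[x∷xs]⇒x∉xs (Unique-resp-↭ front (allFin⁺ n))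

  degree-1⇒leaf : ∀ {x} → degree G x ≡ 1 → ∃ λ w → LeafOf w x
  degree-1⇒leaf {x} deg≡1 with filter (x ~?_) (allFin n) in eq
  degree-1⇒leaf {x} refl | w ∷ [] = w , λ y → mk⇔
    (λ x~y → only (subst (y ∈_) eq (∈-filter⁺ (x ~?_) (∈-allFin y) x~y)))
    (λ { refl → proj₂ (∈-filter⁻ (x ~?_) {xs = allFin n} (subst (w ∈_) (sym eq) (here refl))) })
    where
    only : ∀ {y} → y ∈ w ∷ [] → y ≡ w
    only (here y≡w) = y≡w

  -- Since `vertices` is a permutation of the duplicate-free list `allFin n`, it also says that the
  -- centres and leaves are distinct. Non-adjacency of leaves is implied by `LeafOf`.
  record Layout (r t : ℕ) : Set where
    field
      c d       : Fin n
      Cs Ds     : List (Fin n)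
      length-Cs : length Cs ≡ r
      length-Ds : length Ds ≡ t
      vertices  : allFin n ↭ c ∷ d ∷ Cs ++ Ds
      c~d       : c ~ d
      Cs-leaves : All (LeafOf c) Cs
      Ds-leaves : All (LeafOf d) Ds

  -- Lets results about `c` be reused for `d`.
  flip : ∀ {r t} → Layout r t → Layout t r
  flip L = record
    { c = d ; d = c ; Cs = Ds ; Ds = Cs
    ; length-Cs = length-Ds
    ; length-Ds = length-Cs
    ; vertices  = ↭-trans vertices (↭-swap c d (++-comm Cs Ds))
    ; c~d       = ~-sym c~d
    ; Cs-leaves = Ds-leaves
    ; Ds-leaves = Cs-leaves
    }
    where open Layout L

  exponents⇒order : ∀ {r t} → map (exponent G) (allFin n) ↭ doubleStarExponents r t → n ≡ r + t + 2
  exponents⇒order {r} {t} p = begin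
    n                                      ≡⟨ length-tabulate id ⟨
    length (allFin n)                      ≡⟨ length-map (exponent G) (allFin n) ⟨
    length (map (exponent G) (allFin n))   ≡⟨ ↭-length p ⟩
    length (doubleStarExponents r t)       ≡⟨ cong (2 +_) (length-replicate (r + t)) ⟩
    2 + (r + t)                            ≡⟨ +-comm 2 (r + t) ⟩
    r + t + 2                              ∎
    where open ≡-Reasoning

  module _ {r t : ℕ} (L : Layout r t) where

    open Layout L

    layout⇒order : n ≡ r + t + 2
    layout⇒order = begin
      n                               ≡⟨ length-tabulate id ⟨
      length (allFin n)               ≡⟨ ↭-length vertices ⟩
      2 + length (Cs ++ Ds)           ≡⟨ cong (2 +_) (length-++ Cs) ⟩
      2 + (length Cs + length Ds)     ≡⟨ cong₂ (λ k l → 2 + (k + l)) length-Cs length-Ds ⟩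
      2 + (r + t)                     ≡⟨ +-comm 2 (r + t) ⟩
      r + t + 2                       ∎
      where open ≡-Reasoning

    degree-centre : degree G c ≡ suc r
    degree-centre = begin
      degree G c
        ≡⟨ degree-↭ c vertices ⟩
      length (filter (c ~?_) (c ∷ d ∷ Cs ++ Ds))
        ≡⟨ cong length (filter-reject (c ~?_) (~-irr refl)) ⟩
      length (filter (c ~?_) (d ∷ Cs ++ Ds))
        ≡⟨ cong length (filter-accept (c ~?_) c~d) ⟩
      suc (length (filter (c ~?_) (Cs ++ Ds)))
        ≡⟨ cong (suc ∘ length) (filter-++ (c ~?_) Cs Ds) ⟩
      suc (length (filter (c ~?_) Cs ++ filter (c ~?_) Ds))
        ≡⟨ cong₂ (λ xs ys → suc (length (xs ++ ys)))
             (filter-all (c ~?_) (All.map (λ leaf → ~-sym (from (leaf c) refl)) Cs-leaves))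
             -- A leaf of `d` adjacent to `c` would give c = d, whereas `c~d` excludes this by
             -- irreflexivity.
             (filter-none (c ~?_) (All.map (λ leaf c~x →
               ~-irr (to (leaf c) (~-sym c~x)) c~d) Ds-leaves)) ⟩
      suc (length (Cs ++ []))
        ≡⟨ cong suc (trans (length-++ Cs) (+-identityʳ _)) ⟩
      suc (length Cs)
        ≡⟨ cong suc length-Cs ⟩
      suc r ∎
      where open ≡-Reasoning

    reach-centre : ∀ u → Star (Induced G ⊤) u c
    reach-centre u = go (∈-resp-↭ vertices (∈-allFin u))
      where
      edge : ∀ {u v} → u ~ v → Star (Induced G ⊤) u v
      edge u~v = (∈⊤ , ∈⊤ , u~v) ◅ ε
      go : ∀ {u} → u ∈ c ∷ d ∷ Cs ++ Ds → Star (Induced G ⊤) u c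
      go (here refl)         = ε
      go (there (here refl)) = edge (~-sym c~d)
      go (there (there u∈)) with ∈-++⁻ Cs u∈
      ... | inj₁ u∈Cs = edge (from (All.lookup Cs-leaves u∈Cs c) refl)
      ... | inj₂ u∈Ds = edge (from (All.lookup Ds-leaves u∈Ds d) refl) ◅◅ edge (~-sym c~d)

    connected : Connected G ⊤
    connected u _ v _ = reach-centre u ◅◅
      reverse (λ (_ , _ , x~y) → ∈⊤ , ∈⊤ , ~-sym x~y) (reach-centre v)

  module _ {r t : ℕ} (L : Layout r t) where

    open Layout L

    -- The subtraction in `exponent` is traded for the sum `a + b`, so that the remaining arithmetic
    -- is within reach of the ring solver.
    exponent-≡ : ∀ {u a b} → a + b ≡ r + t + 2 → degree G u ≡ a → exponent G u ≡ b
    exponent-≡ {a = a} {b} eq deg = trans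
      (cong₂ _∸_ (trans (layout⇒order L) (sym eq)) deg) (m+n∸m≡n a b)

    layout⇒exponents : map (exponent G) (allFin n) ↭ doubleStarExponents r t
    layout⇒exponents = ↭-trans (map⁺ (exponent G) vertices) (↭-reflexive
      (cong₂ _∷_ (exponent-≡ (arith₁ r t) (degree-centre L))
      (cong₂ _∷_ (exponent-≡ (arith₂ r t) (degree-centre (flip L)))
        (trans (map-All-≡ leaves)
          (cong (λ k → replicate k (r + t + 1))
            (trans (length-++ Cs) (cong₂ _+_ length-Cs length-Ds)))))))
      where
      arith₁ : ∀ r t → suc r + (t + 1) ≡ r + t + 2
      arith₁ = solve-∀
      arith₂ : ∀ r t → suc t + (r + 1) ≡ r + t + 2
      arith₂ = solve-∀
      arith₃ : ∀ k → 1 + (k + 1) ≡ k + 2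
      arith₃ = solve-∀
      leaf-exponents : ∀ {w xs} → All (LeafOf w) xs → All (λ x → exponent G x ≡ r + t + 1) xs
      leaf-exponents = All.map λ leaf → exponent-≡ (arith₃ (r + t)) (degree-leaf leaf)
      leaves : All (λ x → exponent G x ≡ r + t + 1) (Cs ++ Ds)
      leaves = All.++⁺ (leaf-exponents Cs-leaves) (leaf-exponents Ds-leaves)

    positive-degree : ∀ u → 1 ≤ degree G u
    positive-degree u = All.lookup
      (≤-reflexive′ (degree-centre L) ∷ ≤-reflexive′ (degree-centre (flip L)) ∷
        All.++⁺ (All.map (≤-reflexive′ ∘ degree-leaf) Cs-leaves)
                (All.map (≤-reflexive′ ∘ degree-leaf) Ds-leaves))
      (∈-resp-↭ vertices (∈-allFin u))
      where
      ≤-reflexive′ : ∀ {k l} → k ≡ suc l → 1 ≤ k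
      ≤-reflexive′ refl = s≤s z≤n

    -- On `⊤` the alliance value is the degree plus n, and every degree is at least 1. A leaf of
    -- `c`, which exists because `r` is positive, attains this bound.
    layout⇒[xⁿ]term : 0 < r → [x^ n ] term G ⊤ ≡ 1 ·y^ suc n
    layout⇒[xⁿ]term 0<r = go Cs-leaves (subst (0 <_) (sym length-Cs) 0<r)
      where
      go : ∀ {xs} → All (LeafOf c) xs → 0 < length xs → [x^ n ] term G ⊤ ≡ 1 ·y^ suc n
      go {x ∷ _} (leaf ∷ _) _ = trans
        ([x^]term-minimum G (∣⊤∣≡n n) (connected L) (∈⊤ {x = x}) λ v _ →
          subst₂ _≤_ (sym alliance-x) (sym (alliance-⊤ G v)) (+-monoˡ-≤ n (positive-degree v)))
        (cong (1 ·y^_) alliance-x)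
        where
        alliance-x : alliance G ⊤ x ≡ suc n
        alliance-x = trans (alliance-⊤ G x) (cong (_+ n) (degree-leaf leaf))

-- From exponents and connectivity to a layout.

Star-preserves : ∀ {A : Set} {R : A → A → Set} {P : A → Set} →
  (∀ {x y} → R x y → P x → P y) → ∀ {x y} → Star R x y → P x → P y
Star-preserves step ε          Px = Px
Star-preserves step (xy ◅ yz*) Px = Star-preserves step yz* (step xy Px)

module _ {n : ℕ} (G : Graph n) where

  open Graph G

  module _ {r t : ℕ} (exponents : map (exponent G) (allFin n) ↭ doubleStarExponents r t)
           (connected : Connected G ⊤) where

    degree-≡ : ∀ {u a b} → a + b ≡ r + t + 2 → exponent G u ≡ b → degree G u ≡ a
    degree-≡ {u} {a} {b} eq exp = begin
      degree G u            ≡⟨ m∸[m∸n]≡n degree≤n ⟨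
      n ∸ exponent G u      ≡⟨ cong₂ _∸_ (trans (exponents⇒order G exponents) (sym eq)) exp ⟩
      (a + b) ∸ b           ≡⟨ m+n∸n≡m a b ⟩
      a                     ∎
      where
      open ≡-Reasoning
      degree≤n : degree G u ≤ n
      degree≤n = subst (degree G u ≤_) (length-tabulate id) (length-filter (u ~?_) (allFin n))

    -- Connectivity enters in this form: a non-empty set of vertices closed under adjacency is
    -- everything, so one that misses a vertex is absurd.
    closed⇒all : ∀ {P : Fin n → Set} {u} → (∀ {x y} → x ~ y → P x → P y) → P u → ∀ v → P v
    closed⇒all closed Pu v =
      Star-preserves (λ (_ , _ , x~y) → closed x~y) (connected _ ∈⊤ v ∈⊤) Pu

    exponents⇒layout : Layout G r t
    exponents⇒layout with ↭-map-inv (exponent G) exponents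
    -- Inverting the permutation names the vertices by their position in the exponent list. This
    -- singles out `c` and `d` even when r = t and their degrees agree. The leaves are then split by
    -- adjacency to `c`.
    ... | c ∷ d ∷ leaves , eq , vertices = record
      { c = c ; d = d ; Cs = Cs ; Ds = Ds
      ; length-Cs = length-Cs
      ; length-Ds = +-cancelˡ-≡ r _ _ (trans (cong (_+ length Ds) (sym length-Cs)) length-Cs+Ds)
      ; vertices  = ↭-trans vertices (↭-prep c (↭-prep d (filter-∁-↭ (c ~?_) leaves)))
      ; c~d       = c~d
      ; Cs-leaves = All.map leafOf-c
          (All.zip (All.filter⁺ (c ~?_) hubs , All.all-filter (c ~?_) leaves))
      ; Ds-leaves = All.map leafOf-d
          (All.zip (All.filter⁺ (∁? (c ~?_)) hubs , All.all-filter (∁? (c ~?_)) leaves))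
      }
      where
      Cs Ds : List (Fin n)
      Cs = filter (c ~?_) leaves
      Ds = filter (∁? (c ~?_)) leaves

      degree-c : degree G c ≡ suc r
      degree-c = degree-≡ (arith r t) (sym (∷-injectiveˡ eq))
        where
        arith : ∀ r t → suc r + (t + 1) ≡ r + t + 2
        arith = solve-∀

      map-leaves : replicate (r + t) (r + t + 1) ≡ map (exponent G) leaves
      map-leaves = ∷-injectiveʳ (∷-injectiveʳ eq)

      someLeaf : All (λ x → ∃ λ w → LeafOf G w x) leaves
      someLeaf = All.map (degree-1⇒leaf G ∘ degree-≡ (arith (r + t)))
        (All.map⁻ (subst (All (_≡ r + t + 1)) map-leaves (All.replicate⁺ (r + t) refl)))
        where
        arith : ∀ k → 1 + (k + 1) ≡ k + 2
        arith = solve-∀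

      unique : Unique (c ∷ d ∷ leaves)
      unique = Unique-resp-↭ vertices (allFin⁺ n)

      c∉ : c ∉ d ∷ leaves
      c∉ = Unique[x∷xs]⇒x∉xs unique

      classify : ∀ u → u ≡ c ⊎ u ≡ d ⊎ u ∈ leaves
      classify u with ∈-resp-↭ vertices (∈-allFin u)
      ... | here u≡c         = inj₁ u≡c
      ... | there (here u≡d) = inj₂ (inj₁ u≡d)
      ... | there (there u∈) = inj₂ (inj₂ u∈)

      -- Two adjacent leaves would form a connected component avoiding c.
      hub : ∀ {x w} → x ∈ leaves → LeafOf G w x → w ≡ c ⊎ w ≡ d
      hub {x} {w} x∈ x-leaf with classify w
      ... | inj₁ w≡c        = inj₁ w≡c
      ... | inj₂ (inj₁ w≡d) = inj₂ w≡d
      ... | inj₂ (inj₂ w∈)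
        with w′ , w-leaf ← All.lookup someLeaf w∈
        with refl ← to (w-leaf x) (~-sym (from (x-leaf w) refl))
        with closed⇒all {P = λ y → y ≡ x ⊎ y ≡ w}
               (λ { y~z (inj₁ refl) → inj₂ (to (x-leaf _) y~z)
                  ; y~z (inj₂ refl) → inj₁ (to (w-leaf _) y~z) })
               (inj₁ refl) c
      ... | inj₁ refl = contradiction (there x∈) c∉
      ... | inj₂ refl = contradiction (there w∈) c∉

      hubs : All (λ x → LeafOf G c x ⊎ LeafOf G d x) leaves
      hubs = All.tabulate λ x∈ → leafOf x∈ (All.lookup someLeaf x∈)
        where
        leafOf : ∀ {x} → x ∈ leaves → (∃ λ w → LeafOf G w x) → LeafOf G c x ⊎ LeafOf G d x
        leafOf x∈ (w , leaf) with hub x∈ leaf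
        ... | inj₁ refl = inj₁ leaf
        ... | inj₂ refl = inj₂ leaf

      -- Otherwise c and its leaves would form a connected component avoiding d.
      c~d : c ~ d
      c~d with c ~? d
      ... | yes p = p
      ... | no c≁d with closed⇒all {P = λ y → y ≡ c ⊎ LeafOf G c y}
               (λ { y~z (inj₁ refl) → next y~z
                  ; y~z (inj₂ leaf) → inj₁ (to (leaf _) y~z) })
               (inj₁ refl) d
        where
        next : ∀ {z} → c ~ z → z ≡ c ⊎ LeafOf G c z
        next {z} c~z with classify z
        ... | inj₁ z≡c         = inj₁ z≡c
        ... | inj₂ (inj₁ refl) = contradiction c~z c≁d
        ... | inj₂ (inj₂ z∈) with All.lookup hubs z∈
        ...   | inj₁ leaf = inj₂ leaf
        ...   | inj₂ leaf = contradiction (here (to (leaf c) (~-sym c~z))) c∉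
      ...   | inj₁ d≡c  = contradiction (here (sym d≡c)) c∉
      ...   | inj₂ leaf = ~-sym (from (leaf c) refl)

      -- A leaf of `d` that is adjacent to `c` would have `c` as its only neighbour, forcing c = d.
      leafOf-c : ∀ {x} → (LeafOf G c x ⊎ LeafOf G d x) × c ~ x → LeafOf G c x
      leafOf-c (inj₁ leaf , _)   = leaf
      leafOf-c (inj₂ leaf , c~x) = contradiction (here (to (leaf c) (~-sym c~x))) c∉

      leafOf-d : ∀ {x} → (LeafOf G c x ⊎ LeafOf G d x) × ¬ c ~ x → LeafOf G d x
      leafOf-d (inj₁ leaf , c≁x) = contradiction (~-sym (from (leaf c) refl)) c≁x
      leafOf-d (inj₂ leaf , _)   = leaf

      -- The neighbours of `c` are `d` and the members of `Cs`, so its degree r + 1 gives the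
      -- length; that of `Ds` follows by cancelling from the total r + t.
      length-Cs : length Cs ≡ r
      length-Cs = suc-injective (begin
        suc (length Cs)
          ≡⟨ cong length (filter-accept (c ~?_) c~d) ⟨
        length (filter (c ~?_) (d ∷ leaves))
          ≡⟨ cong length (filter-reject (c ~?_) (~-irr refl)) ⟨
        length (filter (c ~?_) (c ∷ d ∷ leaves))
          ≡⟨ degree-↭ G c vertices ⟨
        degree G c
          ≡⟨ degree-c ⟩
        suc r ∎)
        where open ≡-Reasoning

      length-Cs+Ds : length Cs + length Ds ≡ r + t
      length-Cs+Ds = begin
        length Cs + length Ds                   ≡⟨ length-++ Cs ⟨
        length (Cs ++ Ds)                       ≡⟨ ↭-length (filter-∁-↭ (c ~?_) leaves) ⟨
        length leaves                           ≡⟨ length-map (exponent G) leaves ⟨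
        length (map (exponent G) leaves)        ≡⟨ cong length map-leaves ⟨
        length (replicate (r + t) (r + t + 1))  ≡⟨ length-replicate (r + t) ⟩
        r + t                                   ∎
        where open ≡-Reasoning

-- Layouts and isomorphisms with the double star.

tabulate-splitAt : ∀ {A : Set} m {k} (f : Fin (m + k) → A) →
  tabulate f ≡ tabulate (f ∘ (_↑ˡ k)) ++ tabulate (f ∘ (m ↑ʳ_))
tabulate-splitAt zero    f = refl
tabulate-splitAt (suc m) f = cong (f zero ∷_) (tabulate-splitAt m (f ∘ suc))

tabulate-unique⇒injective : ∀ {A : Set} {m} {f : Fin m → A} → Unique (tabulate f) →
  ∀ i j → f i ≡ f j → i ≡ j
tabulate-unique⇒injective _       zero    zero    _  = refl
tabulate-unique⇒injective {f = f} u zero (suc j) eq =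
  contradiction (subst (_∈ tabulate (f ∘ suc)) (sym eq) (∈-tabulate⁺ j)) (Unique[x∷xs]⇒x∉xs u)
tabulate-unique⇒injective {f = f} u (suc i) zero eq =
  contradiction (subst (_∈ tabulate (f ∘ suc)) eq (∈-tabulate⁺ i)) (Unique[x∷xs]⇒x∉xs u)
tabulate-unique⇒injective (_ ∷ u) (suc i) (suc j) eq =
  cong suc (tabulate-unique⇒injective u i j eq)

module _ (r t : ℕ) where

  open Graph (doubleStar r t)

  leftLeaf : ∀ i v → (suc i ↑ˡ suc t) ~ v ⇔ v ≡ zero ↑ˡ suc t
  leftLeaf i v = mk⇔ forwards λ { refl → inj₁ backwards }
    where
    forwards : (suc i ↑ˡ suc t) ~ v → v ≡ zero ↑ˡ suc t
    -- The added edge only touches the centres. Equality with the left centre is a clash of `suc`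
    -- and `zero` and needs no clause; equality with the right centre is refuted by `splitAt`, which
    -- tells the two sides apart.
    forwards (inj₂ (inj₂ (eq , _)))
      with () ← trans (sym (splitAt-↑ˡ (suc r) (suc i) (suc t)))
                  (trans (cong (splitAt (suc r)) eq) (splitAt-↑ʳ (suc r) (suc t) zero))
    forwards (inj₁ adj) with splitAt (suc r) (suc i ↑ˡ suc t) | splitAt-↑ˡ (suc r) (suc i) (suc t)
                           | splitAt (suc r) v in eq
    forwards (inj₁ (inj₁ leaf-centre)) | _ | refl | inj₁ zero = sym (splitAt⁻¹-↑ˡ eq)
    backwards : Pointwise StarAdj StarAdj
      (splitAt (suc r) (suc i ↑ˡ suc t)) (splitAt (suc r) (zero ↑ˡ suc t))
    backwards = subst (λ u → Pointwise StarAdj StarAdj u (inj₁ zero))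
      (sym (splitAt-↑ˡ (suc r) (suc i) (suc t))) (inj₁ leaf-centre)

  rightLeaf : ∀ i v → (suc r ↑ʳ suc i) ~ v ⇔ v ≡ suc r ↑ʳ zero
  rightLeaf i v = mk⇔ forwards λ { refl → inj₁ backwards }
    where
    forwards : (suc r ↑ʳ suc i) ~ v → v ≡ suc r ↑ʳ zero
    forwards (inj₂ (inj₂ (eq , _)))
      with () ← trans (sym (splitAt-↑ʳ (suc r) (suc t) (suc i)))
                  (trans (cong (splitAt (suc r)) eq) (splitAt-↑ʳ (suc r) (suc t) zero))
    forwards (inj₁ adj) with splitAt (suc r) (suc r ↑ʳ suc i) | splitAt-↑ʳ (suc r) (suc t) (suc i)
                           | splitAt (suc r) v in eq
    forwards (inj₁ (inj₂ leaf-centre)) | _ | refl | inj₂ zero = sym (splitAt⁻¹-↑ʳ eq)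
    backwards : Pointwise StarAdj StarAdj
      (splitAt (suc r) (suc r ↑ʳ suc i)) (splitAt (suc r) (suc r ↑ʳ zero))
    backwards = subst₂ (Pointwise StarAdj StarAdj)
      (sym (splitAt-↑ʳ (suc r) (suc t) (suc i))) (sym (splitAt-↑ʳ (suc r) (suc t) zero))
      (inj₂ leaf-centre)

  centres : (zero ↑ˡ suc t) ~ (suc r ↑ʳ zero)
  centres = inj₂ (inj₁ (refl , refl))

module _ {n : ℕ} {G : Graph n} {r t : ℕ} where

  open Graph G
  private module H = Graph (doubleStar r t)

  ≅⇒layout : G ≅ doubleStar r t → Layout G r t
  ≅⇒layout iso = record
    { c = φ (zero ↑ˡ suc t)
    ; d = φ (suc r ↑ʳ zero)
    ; Cs = tabulate (λ i → φ (suc i ↑ˡ suc t))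
    ; Ds = tabulate (λ i → φ (suc r ↑ʳ suc i))
    ; length-Cs = length-tabulate _
    ; length-Ds = length-tabulate _
    -- The vertices of the double star come in the order c, Cs, d, Ds; `shift` moves d forward.
    ; vertices  = ↭-trans enumeration (↭-trans (↭-reflexive (tabulate-splitAt (suc r) φ))
                    (↭-prep _ (shift _ (tabulate (λ i → φ (suc i ↑ˡ suc t))) _)))
    ; c~d       = from (φ-edge _ _) (centres r t)
    ; Cs-leaves = All.tabulate⁺ λ i → φ-leaf (leftLeaf r t i)
    ; Ds-leaves = All.tabulate⁺ λ i → φ-leaf (rightLeaf r t i)
    }
    where
    open _≅_ iso
    open Inverse bijection using (strictlyInverseˡ; strictlyInverseʳ)
      renaming (to to index; from to φ)

    enumeration : allFin n ↭ tabulate φ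
    enumeration = ∼bag⇒↭ (unique∧set⇒bag (allFin⁺ n)
      (Unique.tabulate⁺ λ {i} {j} eq →
        trans (sym (strictlyInverseˡ i)) (trans (cong index eq) (strictlyInverseˡ j)))
      (mk⇔ (λ _ → subst (_∈ tabulate φ) (strictlyInverseʳ _) (∈-tabulate⁺ {f = φ} (index _)))
           (λ _ → ∈-allFin _)))

    φ-edge : ∀ x y → φ x ~ φ y ⇔ x H.~ y
    φ-edge x y = subst₂ (λ u v → φ x ~ φ y ⇔ u H.~ v)
      (strictlyInverseˡ x) (strictlyInverseˡ y) (preserves (φ x) (φ y))

    φ-leaf : ∀ {x w} → (∀ v → x H.~ v ⇔ v ≡ w) → LeafOf G (φ w) (φ x)
    φ-leaf {x} {w} leaf y = mk⇔
      (λ φx~y → trans (sym (strictlyInverseʳ y)) (cong φ (to (leaf (index y))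
        (to (φ-edge x (index y)) (subst (φ x ~_) (sym (strictlyInverseʳ y)) φx~y)))))
      (λ { refl → from (φ-edge x w) (from (leaf w) refl) })

  layout⇒≅ : Layout G r t → G ≅ doubleStar r t
  layout⇒≅ L = record
    { bijection = mk↔ₛ′ index φ index-φ φ-index
    ; preserves = λ u v → subst₂ (λ x y → x ~ y ⇔ index u H.~ index v)
        (φ-index u) (φ-index v) (φ-edge (index u) (index v))
    }
    where
    open Layout L

    ψ : Fin (suc r) ⊎ Fin (suc t) → Fin n
    ψ (inj₁ zero)    = c
    ψ (inj₁ (suc i)) = lookup Cs (cast (sym length-Cs) i)
    ψ (inj₂ zero)    = d
    ψ (inj₂ (suc i)) = lookup Ds (cast (sym length-Ds) i)

    φ : Fin (suc r + suc t) → Fin n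
    φ = ψ ∘ splitAt (suc r)

    tabulate-cast : ∀ {m} (xs : List (Fin n)) (eq : length xs ≡ m) →
      tabulate (λ i → lookup xs (cast (sym eq) i)) ≡ xs
    tabulate-cast xs refl = trans
      (tabulate-cong λ i → cong (lookup xs) (cast-is-id refl i)) (tabulate-lookup xs)

    enumeration : allFin n ↭ tabulate φ
    enumeration = ↭-trans vertices (↭-trans (↭-prep c (↭-sym (shift d Cs Ds)))
      (↭-reflexive (sym (trans (tabulate-splitAt (suc r) φ) (cong₂ (λ xs ys → c ∷ xs ++ ys)
        (trans (tabulate-cong λ i → cong ψ (splitAt-↑ˡ (suc r) (suc i) (suc t)))
               (tabulate-cast Cs length-Cs))
        (trans (tabulate-cong λ i → cong ψ (splitAt-↑ʳ (suc r) (suc t) i))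
               (cong (d ∷_) (tabulate-cast Ds length-Ds))))))))

    indexed : ∀ u → ∃ λ i → u ≡ φ i
    indexed u = ∈-tabulate⁻ (∈-resp-↭ enumeration (∈-allFin u))

    index : Fin n → Fin (suc r + suc t)
    index = proj₁ ∘ indexed

    φ-index : ∀ u → φ (index u) ≡ u
    φ-index u = sym (proj₂ (indexed u))

    φ-injective : ∀ i j → φ i ≡ φ j → i ≡ j
    φ-injective = tabulate-unique⇒injective (Unique-resp-↭ enumeration (allFin⁺ n))

    -- `index` comes from a membership proof and does not compute usefully, so this inverse law is
    -- derived from the other one by injectivity.
    index-φ : ∀ i → index (φ i) ≡ i
    index-φ i = φ-injective _ i (φ-index (φ i))

    lookup-leaf : ∀ {w xs} → All (LeafOf G w) xs → ∀ i → LeafOf G w (lookup xs i)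
    lookup-leaf leaves i = All.lookup leaves (∈-lookup i)

    φ-left : ∀ i → φ (i ↑ˡ suc t) ≡ ψ (inj₁ i)
    φ-left i = cong ψ (splitAt-↑ˡ (suc r) i (suc t))

    φ-right : ∀ i → φ (suc r ↑ʳ i) ≡ ψ (inj₂ i)
    φ-right i = cong ψ (splitAt-↑ʳ (suc r) (suc t) i)

    -- A vertex that is a leaf in both graphs, at corresponding neighbours. Adjacency at `x` and at
    -- `φ x` is then an equation on both sides, and injectivity of `φ` matches the two.
    CommonLeaf : Fin (suc r + suc t) → Set
    CommonLeaf x = ∃ λ w → (∀ v → x H.~ v ⇔ v ≡ w) × LeafOf G (φ w) (φ x)

    classify : ∀ x → CommonLeaf x ⊎ x ≡ zero ↑ˡ suc t ⊎ x ≡ suc r ↑ʳ zero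
    classify x = subst (λ x → CommonLeaf x ⊎ x ≡ zero ↑ˡ suc t ⊎ x ≡ suc r ↑ʳ zero)
      (join-splitAt (suc r) (suc t) x) (classify-join (splitAt (suc r) x))
      where
      classify-join : ∀ v → let x = join (suc r) (suc t) v in
        CommonLeaf x ⊎ x ≡ zero ↑ˡ suc t ⊎ x ≡ suc r ↑ʳ zero
      classify-join (inj₁ zero)    = inj₂ (inj₁ refl)
      classify-join (inj₂ zero)    = inj₂ (inj₂ refl)
      classify-join (inj₁ (suc i)) = inj₁ (_ , leftLeaf r t i ,
        subst₂ (LeafOf G) (sym (φ-left zero)) (sym (φ-left (suc i))) (lookup-leaf Cs-leaves _))
      classify-join (inj₂ (suc i)) = inj₁ (_ , rightLeaf r t i ,
        subst₂ (LeafOf G) (sym (φ-right zero)) (sym (φ-right (suc i))) (lookup-leaf Ds-leaves _))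

    φ-edge-leaf : ∀ {x} → CommonLeaf x → ∀ y → φ x ~ φ y ⇔ x H.~ y
    φ-edge-leaf (w , leafH , leafG) y = mk⇔
      (from (leafH y) ∘ φ-injective y w ∘ to (leafG (φ y)))
      (from (leafG (φ y)) ∘ cong φ ∘ to (leafH y))

    φ-edge-sym : ∀ {x y} → φ x ~ φ y ⇔ x H.~ y → φ y ~ φ x ⇔ y H.~ x
    φ-edge-sym {x} {y} e = mk⇔
      (H.~-sym {x} {y} ∘ to e ∘ ~-sym) (~-sym ∘ from e ∘ H.~-sym {y} {x})

    φ-edge-centres : φ (zero ↑ˡ suc t) ~ φ (suc r ↑ʳ zero) ⇔ (zero ↑ˡ suc t) H.~ (suc r ↑ʳ zero)
    φ-edge-centres = mk⇔ (λ _ → centres r t)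
      (λ _ → subst₂ _~_ (sym (φ-left zero)) (sym (φ-right zero)) c~d)

    φ-edge-refl : ∀ x → φ x ~ φ x ⇔ x H.~ x
    φ-edge-refl x = mk⇔ (λ e → contradiction e (~-irr refl))
      (λ e → contradiction e (H.~-irr {x} refl))

    -- Every pair with a leaf in it is settled by that leaf, up to symmetry, so only the pairs of
    -- centres remain.
    φ-edge : ∀ x y → φ x ~ φ y ⇔ x H.~ y
    φ-edge x y with classify x | classify y
    ... | inj₁ leaf        | _                = φ-edge-leaf leaf y
    ... | inj₂ _           | inj₁ leaf        = φ-edge-sym {y} {x} (φ-edge-leaf leaf x)
    ... | inj₂ (inj₁ refl) | inj₂ (inj₁ refl) = φ-edge-refl x
    ... | inj₂ (inj₂ refl) | inj₂ (inj₂ refl) = φ-edge-refl x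
    ... | inj₂ (inj₁ refl) | inj₂ (inj₂ refl) = φ-edge-centres
    ... | inj₂ (inj₂ refl) | inj₂ (inj₁ refl) = φ-edge-sym {y} {x} φ-edge-centres

proposition26 : (r t : ℕ) .{{_ : NonZero r}} .{{_ : NonZero t}}
    (n : ℕ) .{{_ : NonZero n}} (G : Graph n) →
    (G ≅ doubleStar r t) ⇔
    ( ([x^ 1 ] da G ≈ʸ (r + t) ·y^ (r + t + 1) ⊕ 1 ·y^ (r + 1) ⊕ 1 ·y^ (t + 1))
    × ([x^ (r + t + 2) ] da G ≈ʸ 1 ·y^ (r + t + 3)) )
proposition26 r t n G = mk⇔ necessary λ (eq₁ , eq₂) → sufficient eq₁ eq₂
  where
  necessary : G ≅ doubleStar r t → _
  necessary iso =
      (λ j → trans (coeff-[x]da G j)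
        (trans (count-↭ (layout⇒exponents G L) j) (sym (coeffʸ-doubleStar r t j))))
    , (λ j → subst (λ m → coeffʸ ([x^ m ] da G) j ≡ coeffʸ (1 ·y^ (r + t + 3)) j) n≡
        (trans (coeff-[xⁿ]da G j) (cong (λ p → coeffʸ p j)
          (trans (layout⇒[xⁿ]term G L (>-nonZero⁻¹ r)) (cong (1 ·y^_) suc-n≡)))))
    where
    L = ≅⇒layout iso
    n≡ : n ≡ r + t + 2
    n≡ = layout⇒order G L
    suc-n≡ : suc n ≡ r + t + 3
    suc-n≡ = trans (cong suc n≡) (sym (+-suc (r + t) 2))

  sufficient : [x^ 1 ] da G ≈ʸ (r + t) ·y^ (r + t + 1) ⊕ 1 ·y^ (r + 1) ⊕ 1 ·y^ (t + 1) →
    [x^ (r + t + 2) ] da G ≈ʸ 1 ·y^ (r + t + 3) → G ≅ doubleStar r t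
  sufficient eq₁ eq₂ = layout⇒≅ (exponents⇒layout G exponents
    -- Connectivity is decidable, so refuting its failure is enough. If it failed, the term of `⊤`
    -- would be zero, and the coefficient of y^(r + t + 3) would be 0 instead of 1. The order
    -- computed from the exponents identifies x^(r + t + 2) with x^n.
    (decidable-stable (connected? G ⊤) λ ¬conn → 1+n≢0 (begin
      1                                        ≡⟨ coeffʸ-monomial-≡ 1 (r + t + 3) ⟨
      coeffʸ (1 ·y^ (r + t + 3)) (r + t + 3)   ≡⟨ eq₂ (r + t + 3) ⟨
      coeffʸ ([x^ (r + t + 2) ] da G) (r + t + 3)
        ≡⟨ cong (λ m → coeffʸ ([x^ m ] da G) (r + t + 3)) (exponents⇒order G exponents) ⟨
      coeffʸ ([x^ n ] da G) (r + t + 3)        ≡⟨ coeff-[xⁿ]da G (r + t + 3) ⟩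
      coeffʸ ([x^ n ] term G ⊤) (r + t + 3)
        ≡⟨ cong (λ p → coeffʸ ([x^ n ] p) (r + t + 3)) (term-disconnected G ¬conn) ⟩
      0 ∎)))
    where
    open ≡-Reasoning
    exponents : map (exponent G) (allFin n) ↭ doubleStarExponents r t
    exponents = count-injective _ _ λ j →
      trans (sym (coeff-[x]da G j)) (trans (eq₁ j) (coeffʸ-doubleStar r t j))
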